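{- Fix an integer $k\ge 3$ and let $A_n,\bar A_n$ ($n\ge 1$) be the antiregular $k$-hypergraphs defined in the context. Then for every $n\ge1$ the independence polynomials $I(A_n;x)$ and $I(\bar A_n;x)$ are log-concave.
   Context: All hypergraphs are $k$-uniform. For a binary string $b=b_1\cdots b_n$, let $H(b)$ be the $k$-uniform hypergraph on $\{1,\dots,n\}$ in which a $k$-subset is a hyperedge iff its largest element $j$ satisfies $b_j=1$ (vertex $j$ is added as isolated if $b_j=0$, and as dominating, forming a hyperedge with every $(k-1)$-subset of earlier vertices, if $b_j=1$). For $1\le n\le k-1$, $A_n=\bar A_n$ is the edgeless hypergraph on $n$ vertices; for $n\ge k$, $A_n=H(b)$ with $b$ of length $n$, $b_1=\dots=b_{k-1}=0$, $b_k,\dots,b_n$ alternating and $b_n=1$, and $\bar A_n$ is the same with $b_n=0$. A vertex set is independent if it contains no hyperedge, and $I(H;x)=\sum_{W\text{ independent}}x^{|W|}$. A polynomial $\sum_{i=0}^m a_ix^i$ of degree $m$ is log-concave if $a_i^2\ge a_{i-1}a_{i+1}$ for all $1\le i\le m-1$. -}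

module Defs where

open import Data.Bool using (Bool; true; false; _∧_; _∨_; not; if_then_else_)
open import Data.Nat using (ℕ; zero; suc; _+_; _*_; _∸_; _≤_; _<_; _≡ᵇ_)
open import Data.Nat.Properties using (_≤?_)
open import Data.Fin using (Fin; toℕ)
open import Data.Vec using (Vec; []; _∷_; lookup; tabulate; count)
open import Data.List using (List; []; _∷_; map; _++_; length; filter)
open import Data.Bool.ListAction using (any)
open import Data.Maybe using (Maybe; just; nothing)
open import Relation.Nullary.Decidable using (does)
open import Relation.Binary.PropositionalEquality using (_≡_)

-- A subset of the vertex set {1,…,n} is a boolean vector of length n;
-- position i : Fin n stands for vertex (toℕ i + 1).
VSet : ℕ → Set
VSet n = Vec Bool n

allSubsets : (n : ℕ) → List (VSet n)
allSubsets zero    = [] ∷ []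
allSubsets (suc n) = map (false ∷_) (allSubsets n) ++ map (true ∷_) (allSubsets n)

card : ∀ {n} → VSet n → ℕ
card v = count (λ x → x Data.Bool.≟ true) v

_⊆ᵇ_ : ∀ {n} → VSet n → VSet n → Bool
[] ⊆ᵇ [] = true
(s ∷ S) ⊆ᵇ (w ∷ W) = (not s ∨ w) ∧ (S ⊆ᵇ W)

largest : ∀ {n} → VSet n → Maybe (Fin n)
largest [] = nothing
largest (x ∷ xs) with largest xs
... | just i  = just (Data.Fin.suc i)
... | nothing = if x then just Data.Fin.zero else nothing

isEdge : (k : ℕ) → ∀ {n} → (b : Vec Bool n) → VSet n → Bool
isEdge k b S with largest S
... | just j  = (card S ≡ᵇ k) ∧ lookup b j
... | nothing = false

isIndependent : (k : ℕ) → ∀ {n} → (b : Vec Bool n) → VSet n → Bool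
isIndependent k {n} b W = not (any (λ S → (S ⊆ᵇ W) ∧ isEdge k b S) (allSubsets n))

indepCoeff : (k : ℕ) → ∀ {n} → (b : Vec Bool n) → ℕ → ℕ
indepCoeff k {n} b i =
  length (filter (λ W → card W Data.Nat.≟ i)
                 (filter (λ W → isIndependent k b W Data.Bool.≟ true) (allSubsets n)))

even : ℕ → Bool
even zero = true
even (suc m) = not (even m)

-- the defining string of A_n (last = true) or Ā_n (last = false):
-- b_j = 0 for j < k; for k ≤ j ≤ n the bits alternate, with b_n = last.
-- Vertex j = toℕ i + 1. (For n < k every bit is 0, giving the edgeless hypergraph.)
antiregularString : (k n : ℕ) → (last : Bool) → Vec Bool n
antiregularString k n last = tabulate λ (i : Fin n) →
  let j = suc (toℕ i) in
  if does (k ≤? j)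
    then (if even (n ∸ j) then last else not last)
    else false

A : (k n : ℕ) → Vec Bool n
A k n = antiregularString k n true

Abar : (k n : ℕ) → Vec Bool n
Abar k n = antiregularString k n false

-- degree of a polynomial with coefficients a, of which all a_i with i > n vanish:
-- largest i ≤ n with a_i ≠ 0 (0 for the zero polynomial)
degreeUpTo : (a : ℕ → ℕ) → ℕ → ℕ
degreeUpTo a zero = 0
degreeUpTo a (suc n) with a (suc n)
... | zero  = degreeUpTo a n
... | suc _ = suc n

LogConcave : (a : ℕ → ℕ) → (m : ℕ) → Set
LogConcave a m = ∀ i → 1 ≤ i → i + 1 ≤ m → a (i ∸ 1) * a (i + 1) ≤ a i * a i

-- I(H;x) for H on n vertices is log-concave (degree ≤ n since sizes ≤ n)
IndepPolyLogConcave : (k : ℕ) → ∀ {n} → Vec Bool n → Set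
IndepPolyLogConcave k {n} b = LogConcave (indepCoeff k b) (degreeUpTo (indepCoeff k b) n)

{-# OPTIONS --safe #-}

-- Put r = k - 1. Deleting the last vertex gives I(Ā_{n+1}) = (1 + x) I(A_n), and multiplication
-- by 1 + x preserves log-concavity without internal zeros. Adding a dominating vertex changes only
-- the coefficients of degree at most r, so A_{n+1} has the binomial coefficients C(n+1, i) for
-- i ≤ r, followed by the coefficients of Ā_n. The only non-trivial inequality is thus the one
-- across the junction, C(n+1, r) g(n) ≤ f(n)², where f(n) and g(n) are the coefficients of degree
-- r + 1 and r + 2 of Ā_n. These satisfy f(n+2) = f(n) + C(n+1, r) and g(n+2) = g(n) + f(n). With
-- c = C(n+1, r), c′ = C(n+3, r) and f = f(n), induction in steps of two reduces the inequality to
-- c′ f (f + c) ≤ c (f + c)², i.e. to c′ f(n) ≤ c f(n+2).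
module Submission where

open import Defs
open import Data.Bool using (Bool; true; false; _∧_; _∨_; not; if_then_else_)
import Data.Bool as Bool
open import Data.Bool.ListAction using (any)
open import Data.Bool.Properties
  using (∨-assoc; ∨-comm; ∨-identityʳ; ∨-zeroʳ; ∨-idem; ∧-zeroʳ; ∧-identityʳ; not-involutive)
open import Data.Fin using (Fin; toℕ)
open import Data.Fin.Properties using (toℕ<n)
open import Data.List using (List; []; _∷_; map; _++_; length; filter)
open import Data.List.Properties using (filter-++; length-++)
open import Data.Maybe using (just; nothing)
open import Data.Nat using (ℕ; zero; suc; _+_; _*_; _∸_; _≤_; _<_; _≡ᵇ_; _≤ᵇ_; z≤n; s≤s; NonZero)
import Data.Nat as ℕ
open import Data.Nat.Combinatorics using (_C_; nCk+nC[k+1]≡[n+1]C[k+1]; k>n⇒nCk≡0)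
open import Data.Nat.Properties
open import Data.Nat.Tactic.RingSolver using (solve-∀)
open import Data.Product using (_×_; _,_)
open import Data.Sum using (inj₁; inj₂)
open import Data.Vec using (Vec; []; _∷_; _∷ʳ_; tabulate)
open import Data.Vec.Properties using (tabulate-cong)
open import Function using (_∘_)
open import Relation.Nullary using (yes; no; contradiction)
open import Relation.Binary.Definitions using (tri<; tri≈; tri>)
open import Relation.Binary.PropositionalEquality
  using (_≡_; _≗_; refl; sym; trans; cong; cong₂; subst; module ≡-Reasoning)

-- Binomial coefficients

nCk≤[n+1]Ck : ∀ n k → n C k ≤ suc n C k
nCk≤[n+1]Ck n zero    = ≤-refl
nCk≤[n+1]Ck n (suc k) = subst (n C suc k ≤_) (nCk+nC[k+1]≡[n+1]C[k+1] n k) (m≤n+m _ _)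

-- Induction on `n` by Pascal's rule. This is the division-free form of C(n, k+1) / C(n, k) = (n -
-- k) / (k + 1); for `k ≥ n` both sides vanish, so truncated subtraction does no harm.
[k+1]*nC[k+1]≡[n∸k]*nCk : ∀ n k → suc k * (n C suc k) ≡ (n ∸ k) * (n C k)
[k+1]*nC[k+1]≡[n∸k]*nCk zero zero = refl
[k+1]*nC[k+1]≡[n∸k]*nCk zero (suc k) = *-zeroʳ (2 + k)
[k+1]*nC[k+1]≡[n∸k]*nCk (suc n) zero = begin
  1 * (suc n C 1)  ≡⟨ cong (1 *_) (nCk+nC[k+1]≡[n+1]C[k+1] n 0) ⟨
  1 * (1 + n C 1)  ≡⟨ *-distribˡ-+ 1 1 (n C 1) ⟩
  1 + 1 * (n C 1)  ≡⟨ cong (1 +_) ([k+1]*nC[k+1]≡[n∸k]*nCk n 0) ⟩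
  suc n * 1        ∎
  where open ≡-Reasoning
[k+1]*nC[k+1]≡[n∸k]*nCk (suc n) (suc k) = begin
  (2 + k) * (suc n C (2 + k))            ≡⟨ cong ((2 + k) *_) (nCk+nC[k+1]≡[n+1]C[k+1] n (suc k)) ⟨
  (2 + k) * (c + n C (2 + k))            ≡⟨ *-distribˡ-+ (2 + k) c _ ⟩
  (2 + k) * c + (2 + k) * (n C (2 + k))  ≡⟨ cong ((2 + k) * c +_) ([k+1]*nC[k+1]≡[n∸k]*nCk n (suc k)) ⟩
  (2 + k) * c + (n ∸ suc k) * c          ≡⟨ rearrange ⟩
  suc k * c + (n ∸ k) * c                ≡⟨ cong (_+ (n ∸ k) * c) ([k+1]*nC[k+1]≡[n∸k]*nCk n k) ⟩
  (n ∸ k) * (n C k) + (n ∸ k) * c        ≡⟨ *-distribˡ-+ (n ∸ k) (n C k) c ⟨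
  (n ∸ k) * (n C k + c)                  ≡⟨ cong ((n ∸ k) *_) (nCk+nC[k+1]≡[n+1]C[k+1] n k) ⟩
  (n ∸ k) * (suc n C suc k)              ∎
  where
  open ≡-Reasoning
  c = n C suc k
  shift : ∀ k m c → (2 + k) * c + m * c ≡ suc k * c + (1 + m) * c
  shift = solve-∀
  rearrange : (2 + k) * c + (n ∸ suc k) * c ≡ suc k * c + (n ∸ k) * c
  -- If `k < n`, then `n ∸ k` is `1 + (n ∸ suc k)` and one copy of `c` changes sides; otherwise `c`
  -- is zero.
  rearrange with k <? n
  ... | yes k<n rewrite +-∸-assoc 1 k<n = shift k (n ∸ suc k) c
  ... | no  k≮n rewrite k>n⇒nCk≡0 (s≤s (≮⇒≥ k≮n)) | *-zeroʳ k | *-zeroʳ (n ∸ suc k) | *-zeroʳ (n ∸ k) = refl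

nCk≡0⇒nC[k+1]≡0 : ∀ n k → n C k ≡ 0 → n C suc k ≡ 0
-- `suc k * x` unfolds to `x + k * x`, so `x` vanishes with it.
nCk≡0⇒nC[k+1]≡0 n k eq = m+n≡0⇒m≡0 (n C suc k)
  (trans ([k+1]*nC[k+1]≡[n∸k]*nCk n k) (trans (cong ((n ∸ k) *_) eq) (*-zeroʳ (n ∸ k))))

-- The ratio (n - k) / (k + 1) of consecutive binomials grows with `n`.
C-ratio-mono : ∀ {m n} k → m ≤ n → (m C suc k) * (n C k) ≤ (m C k) * (n C suc k)
C-ratio-mono {m} {n} k m≤n = *-cancelˡ-≤ (suc k) (begin
  suc k * ((m C suc k) * (n C k))  ≡⟨ *-assoc (suc k) (m C suc k) (n C k) ⟨
  suc k * (m C suc k) * (n C k)    ≡⟨ cong (_* (n C k)) ([k+1]*nC[k+1]≡[n∸k]*nCk m k) ⟩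
  (m ∸ k) * (m C k) * (n C k)      ≤⟨ *-monoˡ-≤ (n C k) (*-monoˡ-≤ (m C k) (∸-monoˡ-≤ k m≤n)) ⟩
  (n ∸ k) * (m C k) * (n C k)      ≡⟨ xy∙z (n ∸ k) (m C k) (n C k) ⟩
  (m C k) * ((n ∸ k) * (n C k))    ≡⟨ cong ((m C k) *_) ([k+1]*nC[k+1]≡[n∸k]*nCk n k) ⟨
  (m C k) * (suc k * (n C suc k))  ≡⟨ x∙yz (m C k) (suc k) (n C suc k) ⟩
  suc k * ((m C k) * (n C suc k))  ∎)
  where
  open ≤-Reasoning
  xy∙z : ∀ x y z → x * y * z ≡ y * (x * z)
  xy∙z = solve-∀
  x∙yz : ∀ x y z → x * (y * z) ≡ y * (x * z)
  x∙yz = solve-∀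

-- The ratio (n - k) / (k + 1) falls as `k` grows; numerator and denominator are compared
-- separately.
C-logConcave : ∀ n k → (n C k) * (n C (2 + k)) ≤ (n C suc k) * (n C suc k)
C-logConcave n k = *-cancelˡ-≤ (2 + k) (begin
  (2 + k) * (a * c)        ≡⟨ x∙yz (2 + k) a c ⟩
  a * ((2 + k) * c)        ≡⟨ cong (a *_) ([k+1]*nC[k+1]≡[n∸k]*nCk n (suc k)) ⟩
  a * ((n ∸ suc k) * b)    ≤⟨ *-monoʳ-≤ a (*-monoˡ-≤ b (∸-monoʳ-≤ n (n≤1+n k))) ⟩
  a * ((n ∸ k) * b)        ≡⟨ x∙yz′ a (n ∸ k) b ⟩
  (n ∸ k) * a * b          ≡⟨ cong (_* b) ([k+1]*nC[k+1]≡[n∸k]*nCk n k) ⟨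
  suc k * b * b            ≡⟨ *-assoc (suc k) b b ⟩
  suc k * (b * b)          ≤⟨ *-monoˡ-≤ (b * b) (n≤1+n (suc k)) ⟩
  (2 + k) * (b * b)        ∎)
  where
  open ≤-Reasoning
  a = n C k
  b = n C suc k
  c = n C (2 + k)
  x∙yz : ∀ x y z → x * (y * z) ≡ y * (x * z)
  x∙yz = solve-∀
  x∙yz′ : ∀ x y z → x * (y * z) ≡ y * x * z
  x∙yz′ = solve-∀

-- By Pascal's rule C(n+1, k+1) / C(n, k+1) is 1 plus C(n, k) / C(n, k+1), which falls as `n` grows
-- by `C-ratio-mono`.
C-logConcaveˡ : ∀ {m n} k → m ≤ n → (m C k) * (suc n C k) ≤ (suc m C k) * (n C k)
C-logConcaveˡ zero m≤n = ≤-refl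
C-logConcaveˡ {m} {n} (suc k) m≤n = begin
  (m C suc k) * (suc n C suc k)                        ≡⟨ cong ((m C suc k) *_) (nCk+nC[k+1]≡[n+1]C[k+1] n k) ⟨
  (m C suc k) * (n C k + n C suc k)                    ≡⟨ *-distribˡ-+ (m C suc k) _ _ ⟩
  (m C suc k) * (n C k) + (m C suc k) * (n C suc k)    ≤⟨ +-monoˡ-≤ _ (C-ratio-mono k m≤n) ⟩
  (m C k) * (n C suc k) + (m C suc k) * (n C suc k)    ≡⟨ *-distribʳ-+ (n C suc k) (m C k) _ ⟨
  (m C k + m C suc k) * (n C suc k)                    ≡⟨ cong (_* (n C suc k)) (nCk+nC[k+1]≡[n+1]C[k+1] m k) ⟩
  (suc m C suc k) * (n C suc k)                        ∎
  where open ≤-Reasoning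

C-logConcaveˡ₂ : ∀ {m n} k → m ≤ n → (m C k) * ((2 + n) C k) ≤ ((2 + m) C k) * (n C k)
C-logConcaveˡ₂ {m} {n} k m≤n with m≤n⇒m<n∨m≡n m≤n
-- The second link of the chain below needs `suc m ≤ n`; at `m = n` the two sides agree.
... | inj₂ refl = ≤-reflexive (*-comm (m C k) _)
... | inj₁ m<n = begin
  (m C k) * ((2 + n) C k)      ≤⟨ C-logConcaveˡ k (m≤n⇒m≤1+n m≤n) ⟩
  (suc m C k) * (suc n C k)    ≤⟨ C-logConcaveˡ k m<n ⟩
  ((2 + m) C k) * (n C k)      ∎
  where open ≤-Reasoning

-- Log-concave sequences

-- Log-concavity by itself is not preserved under multiplication by 1 + x: (1 + x)(1 + x³) = 1 + x +
-- x³ + x⁴ has a gap at x². Carrying `noGap` along repairs this.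
record LogConcaveSeq (a : ℕ → ℕ) : Set where
  field
    logConcave : ∀ i → a i * a (2 + i) ≤ a (1 + i) * a (1 + i)
    noGap      : ∀ i → a i ≡ 0 → a (suc i) ≡ 0

  -- The product of two consecutive inequalities has the common factor `a (1 + i) * a (2 + i)`,
  -- which cancels if positive. If it is zero, `noGap` makes `a (3 + i)` zero.
  logConcave₃ : ∀ i → a i * a (3 + i) ≤ a (1 + i) * a (2 + i)
  logConcave₃ i with a (1 + i) * a (2 + i) in eq
  ... | suc p = *-cancelˡ-≤ (suc p) (begin
    suc p * (a i * a (3 + i))                           ≡⟨ cong (_* (a i * a (3 + i))) eq ⟨
    a (1 + i) * a (2 + i) * (a i * a (3 + i))           ≡⟨ pair (a i) (a (1 + i)) (a (2 + i)) (a (3 + i)) ⟩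
    (a i * a (2 + i)) * (a (1 + i) * a (3 + i))         ≤⟨ *-mono-≤ (logConcave i) (logConcave (1 + i)) ⟩
    a (1 + i) * a (1 + i) * (a (2 + i) * a (2 + i))     ≡⟨ square (a (1 + i)) (a (2 + i)) ⟩
    a (1 + i) * a (2 + i) * (a (1 + i) * a (2 + i))     ≡⟨ cong (λ q → q * q) eq ⟩
    suc p * suc p                                       ∎)
    where
    open ≤-Reasoning
    pair : ∀ w x y z → x * y * (w * z) ≡ (w * y) * (x * z)
    pair = solve-∀
    square : ∀ x y → x * x * (y * y) ≡ x * y * (x * y)
    square = solve-∀
  ... | zero = ≤-reflexive (trans (cong (a i *_) a₃≡0) (*-zeroʳ (a i)))
    where
    a₃≡0 : a (3 + i) ≡ 0
    a₃≡0 with m*n≡0⇒m≡0∨n≡0 (a (1 + i)) eq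
    ... | inj₁ a₁≡0 = noGap (2 + i) (noGap (1 + i) a₁≡0)
    ... | inj₂ a₂≡0 = noGap (2 + i) a₂≡0

open LogConcaveSeq

[1+x]* : (ℕ → ℕ) → ℕ → ℕ
[1+x]* a zero    = a zero
[1+x]* a (suc i) = a (suc i) + a i

-- The expanded products pair off as two instances of log-concavity, one of `logConcave₃` and one
-- product common to both sides. At index `zero` there is no earlier coefficient, and `logConcave 0`
-- suffices.
[1+x]*-logConcave : ∀ {a} → LogConcaveSeq a → LogConcaveSeq ([1+x]* a)
[1+x]*-logConcave {a} lc .logConcave zero = begin
  a 0 * (a 2 + a 1)                                      ≤⟨ m≤m+n _ (a 0 * a 1 + a 0 * a 0) ⟩
  a 0 * (a 2 + a 1) + (a 0 * a 1 + a 0 * a 0)            ≡⟨ expand (a 0) (a 1) (a 2) ⟩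
  a 0 * a 2 + (a 1 * a 0 + (a 0 * a 1 + a 0 * a 0))      ≤⟨ +-monoˡ-≤ _ (lc .logConcave 0) ⟩
  a 1 * a 1 + (a 1 * a 0 + (a 0 * a 1 + a 0 * a 0))      ≡⟨ collect (a 0) (a 1) ⟩
  (a 1 + a 0) * (a 1 + a 0)                              ∎
  where
  open ≤-Reasoning
  expand : ∀ x y z → x * (z + y) + (x * y + x * x) ≡ x * z + (y * x + (x * y + x * x))
  expand = solve-∀
  collect : ∀ x y → y * y + (y * x + (x * y + x * x)) ≡ (y + x) * (y + x)
  collect = solve-∀
[1+x]*-logConcave {a} lc .logConcave (suc i) = begin
  (a₁ + a₀) * (a₃ + a₂)                                ≡⟨ expand a₀ a₁ a₂ a₃ ⟩
  a₁ * a₃ + a₀ * a₂ + (a₀ * a₃ + a₁ * a₂)              ≤⟨ +-mono-≤ (+-mono-≤ (lc .logConcave (1 + i)) (lc .logConcave i))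
                                                            (+-monoˡ-≤ _ (logConcave₃ lc i)) ⟩
  a₂ * a₂ + a₁ * a₁ + (a₁ * a₂ + a₁ * a₂)              ≡⟨ collect a₁ a₂ ⟩
  (a₂ + a₁) * (a₂ + a₁)                                ∎
  where
  open ≤-Reasoning
  a₀ = a i
  a₁ = a (1 + i)
  a₂ = a (2 + i)
  a₃ = a (3 + i)
  expand : ∀ w x y z → (x + w) * (z + y) ≡ x * z + w * y + (w * z + x * y)
  expand = solve-∀
  collect : ∀ x y → y * y + x * x + (x * y + x * y) ≡ (y + x) * (y + x)
  collect = solve-∀
[1+x]*-logConcave lc .noGap zero    a₀≡0 rewrite a₀≡0 = trans (+-identityʳ _) (lc .noGap 0 a₀≡0)
[1+x]*-logConcave {a} lc .noGap (suc i) b≡0 = cong₂ _+_ (lc .noGap (suc i) a₁≡0) a₁≡0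
  where a₁≡0 = m+n≡0⇒m≡0 (a (suc i)) b≡0

-- The coefficients of the antiregular hypergraphs

-- coeff r l n is the coefficient sequence of I(A_n; x) for l = true and of
-- I(Ā_n; x) for l = false, where r = k - 1.
coeff : ℕ → Bool → ℕ → ℕ → ℕ
coeff r l zero    zero    = 1
coeff r l zero    (suc i) = 0
coeff r l (suc n) zero    = 1
coeff r l (suc n) (suc i) =
  coeff r (not l) n (suc i) + (if l ∧ (r ≤ᵇ i) then 0 else coeff r (not l) n i)

coeff-0 : ∀ r l n → coeff r l n 0 ≡ 1
coeff-0 r l zero    = refl
coeff-0 r l (suc n) = refl

≤⇒≤ᵇ≡true : ∀ {m n} → m ≤ n → (m ≤ᵇ n) ≡ true
≤⇒≤ᵇ≡true {m} {n} m≤n with m ≤ᵇ n | ≤⇒≤ᵇ m≤n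
... | true | _ = refl

<⇒≤ᵇ≡false : ∀ {m n} → n < m → (m ≤ᵇ n) ≡ false
<⇒≤ᵇ≡false {m} {n} n<m with m ≤ᵇ n in eq
... | false = refl
... | true  = contradiction (≤ᵇ⇒≤ m n (subst Bool.T (sym eq) _)) (<⇒≱ n<m)

if-≤ : ∀ b m → (if b then 0 else m) ≤ m
if-≤ true  m = z≤n
if-≤ false m = ≤-refl

-- A set of more than `r` vertices through the dominating last vertex contains an edge, so only sets
-- avoiding that vertex remain.
coeff-A : ∀ {r i} n → r ≤ i → coeff r true (suc n) (suc i) ≡ coeff r false n (suc i)
coeff-A n r≤i rewrite ≤⇒≤ᵇ≡true r≤i = +-identityʳ _

coeff-Ā : ∀ r n i → coeff r false (suc n) i ≡ [1+x]* (coeff r true n) i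
coeff-Ā r n zero    = sym (coeff-0 r true n)
coeff-Ā r n (suc i) = refl

coeff≤C : ∀ r l n i → coeff r l n i ≤ n C i
coeff≤C r l zero    zero    = ≤-refl
coeff≤C r l zero    (suc i) = z≤n
coeff≤C r l (suc n) zero    = ≤-refl
coeff≤C r l (suc n) (suc i) = begin
  coeff r (not l) n (suc i) + (if l ∧ (r ≤ᵇ i) then 0 else coeff r (not l) n i)
    ≤⟨ +-mono-≤ (coeff≤C r (not l) n (suc i)) (≤-trans (if-≤ (l ∧ (r ≤ᵇ i)) _) (coeff≤C r (not l) n i)) ⟩
  n C suc i + n C i   ≡⟨ +-comm (n C suc i) (n C i) ⟩
  n C i + n C suc i   ≡⟨ nCk+nC[k+1]≡[n+1]C[k+1] n i ⟩
  suc n C suc i       ∎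
  where open ≤-Reasoning

-- Sets of at most `r = k - 1` vertices are too small to contain an edge; formally, the guard in
-- `coeff` never fires for `i < r`.
coeff≡C : ∀ r l n i → i ≤ r → coeff r l n i ≡ n C i
coeff≡C r l zero    zero    _ = refl
coeff≡C r l zero    (suc i) _ = refl
coeff≡C r l (suc n) zero    _ = refl
coeff≡C r l (suc n) (suc i) i<r rewrite <⇒≤ᵇ≡false i<r | ∧-zeroʳ l = begin
  coeff r (not l) n (suc i) + coeff r (not l) n i
    ≡⟨ cong₂ _+_ (coeff≡C r (not l) n (suc i) i<r) (coeff≡C r (not l) n i (<⇒≤ i<r)) ⟩
  n C suc i + n C i   ≡⟨ +-comm (n C suc i) (n C i) ⟩
  n C i + n C suc i   ≡⟨ nCk+nC[k+1]≡[n+1]C[k+1] n i ⟩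
  suc n C suc i       ∎
  where open ≡-Reasoning

-- The inequality across the junction and log-concavity of all coefficients

module _ (r-1 : ℕ) where

  private
    r = suc r-1
    f g : ℕ → ℕ
    f n = coeff r false n (1 + r)
    g n = coeff r false n (2 + r)

    -- The recursion treats the two new vertices as dominating, then isolated. Sets through the
    -- isolated one have `r` further vertices and are unrestricted; in `g-step` they have `r + 1`
    -- and must avoid the dominating one.
    f-step : ∀ n → f (2 + n) ≡ f n + suc n C r
    f-step n = cong₂ _+_ (coeff-A n ≤-refl) (coeff≡C r true (suc n) r ≤-refl)

    g-step : ∀ n → g (2 + n) ≡ g n + f n
    g-step n = cong₂ _+_ (coeff-A n (n≤1+n r)) (coeff-A n ≤-refl)

    -- f is the sequence of partial sums, in steps of two, of n ↦ n C r; log-concavity of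
    -- the latter makes the ratio of summand to partial sum decrease.
    summand/sum-antitone : ∀ m n → suc m ≤ n → ((2 + n) C r) * f m ≤ (n C r) * f (2 + m)
    -- `f 0` and `f 1` compute to `0`, the latter because `r` is a successor.
    summand/sum-antitone 0 n _ rewrite *-zeroʳ ((2 + n) C r) = z≤n
    summand/sum-antitone 1 n _ rewrite *-zeroʳ ((2 + n) C r) = z≤n
    summand/sum-antitone (suc (suc m)) n 3+m≤n = begin
      c′ * f (2 + m)                            ≡⟨ cong (c′ *_) (f-step m) ⟩
      c′ * (f m + suc m C r)                    ≡⟨ *-distribˡ-+ c′ (f m) _ ⟩
      c′ * f m + c′ * (suc m C r)               ≤⟨ +-mono-≤ (summand/sum-antitone m n 1+m≤n) (≤-trans (≤-reflexive (*-comm c′ _)) (C-logConcaveˡ₂ r 1+m≤n)) ⟩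
      c * f (2 + m) + ((3 + m) C r) * c         ≡⟨ cong (c * f (2 + m) +_) (*-comm _ c) ⟩
      c * f (2 + m) + c * ((3 + m) C r)         ≡⟨ *-distribˡ-+ c (f (2 + m)) _ ⟨
      c * (f (2 + m) + (3 + m) C r)             ≡⟨ cong (c *_) (f-step (2 + m)) ⟨
      c * f (4 + m)                             ∎
      where
      open ≤-Reasoning
      c = n C r
      c′ = (2 + n) C r
      1+m≤n : suc m ≤ n
      1+m≤n = ≤-trans (m≤n+m (suc m) 2) 3+m≤n

    f≤C : ∀ n → f n ≤ n C suc r
    f≤C n = coeff≤C r false n (suc r)

    -- The induction advances by two to match `f-step` and `g-step`. It ends by cancelling
    -- `c = suc n C r`, so the case in which that binomial vanishes is treated apart.
    junction : ∀ n → (suc n C r) * g n ≤ f n * f n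
    junction 0 rewrite *-zeroʳ (1 C r) = z≤n
    junction 1 rewrite *-zeroʳ (2 C r) = z≤n
    junction (suc (suc n)) with suc n C r in eq
    -- The summands `g n` and `f n` of `g (2 + n)` are bounded by C(n, r+2) and C(n, r+1), which
    -- vanish together with C(n+1, r).
    ... | zero = ≤-trans (≤-reflexive (trans (cong (((3 + n) C r) *_) g≡0) (*-zeroʳ ((3 + n) C r)))) z≤n
      where
      [1+n]C[1+r]≡0 : suc n C suc r ≡ 0
      [1+n]C[1+r]≡0 = nCk≡0⇒nC[k+1]≡0 (suc n) r eq
      nC[1+r]≡0 : n C suc r ≡ 0
      nC[1+r]≡0 = n≤0⇒n≡0 (subst (n C suc r ≤_) [1+n]C[1+r]≡0 (nCk≤[n+1]Ck n (suc r)))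
      g≡0 : g (2 + n) ≡ 0
      g≡0 = trans (g-step n) (cong₂ _+_
        (n≤0⇒n≡0 (subst (g n ≤_) (nCk≡0⇒nC[k+1]≡0 n (suc r) nC[1+r]≡0) (coeff≤C r false n (2 + r))))
        (n≤0⇒n≡0 (subst (f n ≤_) nC[1+r]≡0 (f≤C n))))
    ... | suc c-1 = *-cancelˡ-≤ c (begin
      c * (c′ * g (2 + n))                 ≡⟨ cong (λ x → c * (c′ * x)) (g-step n) ⟩
      c * (c′ * (g n + f n))               ≡⟨ expand c c′ (g n) (f n) ⟩
      c′ * (c * g n) + c′ * (c * f n)      ≤⟨ +-monoˡ-≤ _ (*-monoʳ-≤ c′ (subst (λ x → x * g n ≤ f n * f n) eq (junction n))) ⟩
      c′ * (f n * f n) + c′ * (c * f n)    ≡⟨ collect c c′ (f n) ⟩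
      c′ * f n * (f n + c)                 ≤⟨ *-monoˡ-≤ (f n + c) (subst (λ x → c′ * f n ≤ x * f (2 + n)) eq (summand/sum-antitone n (suc n) ≤-refl)) ⟩
      c * f (2 + n) * (f n + c)            ≡⟨ *-assoc c (f (2 + n)) (f n + c) ⟩
      c * (f (2 + n) * (f n + c))          ≡⟨ cong (λ x → c * (f (2 + n) * (f n + x))) eq ⟨
      c * (f (2 + n) * (f n + suc n C r))  ≡⟨ cong (λ x → c * (f (2 + n) * x)) (f-step n) ⟨
      c * (f (2 + n) * f (2 + n))          ∎)
      where
      open ≤-Reasoning
      c = suc c-1
      c′ = (3 + n) C r
      expand : ∀ c c′ g f → c * (c′ * (g + f)) ≡ c′ * (c * g) + c′ * (c * f)
      expand = solve-∀
      collect : ∀ c c′ f → c′ * (f * f) + c′ * (c * f) ≡ c′ * f * (f + c)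
      collect = solve-∀

  -- Induction on `n`, alternating between the two families. For `true`, indices below `r` are
  -- settled by binomials, index `r` by `junction`, and indices above `r` by the induction
  -- hypothesis for the preceding `false` sequence.
  coeff-logConcave : ∀ l n → LogConcaveSeq (coeff r l n)
  coeff-logConcave l zero .logConcave i = ≤-trans (≤-reflexive (*-zeroʳ (coeff r l 0 i))) z≤n
  coeff-logConcave l zero .noGap i _ = refl
  coeff-logConcave false (suc n) .logConcave i =
    subst (_≤ coeff r false (suc n) (1 + i) * coeff r false (suc n) (1 + i))
      (cong (_* coeff r false (suc n) (2 + i)) (sym (coeff-Ā r n i)))
      ([1+x]*-logConcave (coeff-logConcave true n) .logConcave i)
  coeff-logConcave false (suc n) .noGap i eq =
    [1+x]*-logConcave (coeff-logConcave true n) .noGap i (trans (sym (coeff-Ā r n i)) eq)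
  coeff-logConcave true (suc n) .logConcave i with <-cmp i r
  -- Degree `2 + i` may be `r + 1`, where only the binomial upper bound is available; it is enough
  -- that the middle coefficient is exact.
  ... | tri< i<r _ _ = begin
    coeff r true (suc n) i * coeff r true (suc n) (2 + i)  ≤⟨ *-mono-≤ (coeff≤C r true (suc n) i) (coeff≤C r true (suc n) (2 + i)) ⟩
    (suc n C i) * (suc n C (2 + i))                        ≤⟨ C-logConcave (suc n) i ⟩
    (suc n C suc i) * (suc n C suc i)                      ≡⟨ cong (λ x → x * x) (coeff≡C r true (suc n) (suc i) i<r) ⟨
    coeff r true (suc n) (suc i) * coeff r true (suc n) (suc i) ∎
    where open ≤-Reasoning
  ... | tri≈ _ refl _ = begin
    coeff r true (suc n) r * coeff r true (suc n) (2 + r)  ≡⟨ cong₂ _*_ (coeff≡C r true (suc n) r ≤-refl) (coeff-A n (n≤1+n r)) ⟩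
    (suc n C r) * g n                                      ≤⟨ junction n ⟩
    f n * f n                                              ≡⟨ cong (λ x → x * x) (coeff-A n ≤-refl) ⟨
    coeff r true (suc n) (suc r) * coeff r true (suc n) (suc r) ∎
    where open ≤-Reasoning
  coeff-logConcave true (suc n) .logConcave (suc i) | tri> _ _ (s≤s r≤i)
    rewrite coeff-A n r≤i | coeff-A n (m≤n⇒m≤1+n r≤i) | coeff-A n (m≤n⇒m≤1+n (m≤n⇒m≤1+n r≤i)) =
    coeff-logConcave false n .logConcave (suc i)
  coeff-logConcave true (suc n) .noGap i eq with i ≤? r
  -- Degree `i` carries the full binomial, so C(n+1, i+1) vanishes too; it bounds the next
  -- coefficient even at `i = r`.
  ... | yes i≤r = n≤0⇒n≡0 (subst (coeff r true (suc n) (suc i) ≤_)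
    (nCk≡0⇒nC[k+1]≡0 (suc n) i (trans (sym (coeff≡C r true (suc n) i i≤r)) eq)) (coeff≤C r true (suc n) (suc i)))
  coeff-logConcave true (suc n) .noGap zero eq | no i≰r = contradiction z≤n i≰r
  coeff-logConcave true (suc n) .noGap (suc i) eq | no i≰r with ≰⇒> i≰r
  ... | s≤s r≤i = trans (coeff-A n (m≤n⇒m≤1+n r≤i)) (coeff-logConcave false n .noGap (suc i) (trans (sym (coeff-A n r≤i)) eq))

-- Independence of a vertex set as a scan from left to right

any-map : ∀ {A B : Set} (p : B → Bool) (h : A → B) xs → any p (map h xs) ≡ any (p ∘ h) xs
any-map p h []       = refl
any-map p h (x ∷ xs) = cong (p (h x) ∨_) (any-map p h xs)

any-++ : ∀ {A : Set} (p : A → Bool) xs ys → any p (xs ++ ys) ≡ any p xs ∨ any p ys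
any-++ p []       ys = refl
any-++ p (x ∷ xs) ys = trans (cong (p x ∨_) (any-++ p xs ys)) (sym (∨-assoc (p x) _ _))

any-cong : ∀ {A : Set} {p q : A → Bool} → p ≗ q → any p ≗ any q
any-cong p≗q []       = refl
any-cong p≗q (x ∷ xs) = cong₂ _∨_ (p≗q x) (any-cong p≗q xs)

any-false : ∀ {A : Set} (xs : List A) → any (λ _ → false) xs ≡ false
any-false []       = refl
any-false (x ∷ xs) = any-false xs

any-allSubsets : ∀ {n} (p : VSet (suc n) → Bool) →
  any p (allSubsets (suc n)) ≡ any (p ∘ (false ∷_)) (allSubsets n) ∨ any (p ∘ (true ∷_)) (allSubsets n)
any-allSubsets {n} p = trans (any-++ p (map (false ∷_) (allSubsets n)) _)
  (cong₂ _∨_ (any-map p (false ∷_) (allSubsets n)) (any-map p (true ∷_) (allSubsets n)))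

largest≡nothing⇒card≡0 : ∀ {n} (S : VSet n) → largest S ≡ nothing → card S ≡ 0
largest≡nothing⇒card≡0 [] _ = refl
largest≡nothing⇒card≡0 (x ∷ S) eq with largest S in eqS
largest≡nothing⇒card≡0 (false ∷ S) eq | nothing = largest≡nothing⇒card≡0 S eqS

largest≡just⇒card>0 : ∀ {n} (S : VSet n) {j} → largest S ≡ just j → NonZero (card S)
largest≡just⇒card>0 (true ∷ S) eq = _
largest≡just⇒card>0 (false ∷ S) eq with largest S in eqS
... | just _ = largest≡just⇒card>0 S eqS

isEdge-false∷ : ∀ d {n} b (bs : Vec Bool n) S → isEdge d (b ∷ bs) (false ∷ S) ≡ isEdge d bs S
isEdge-false∷ d b bs S with largest S
... | just _  = refl
... | nothing = refl

isEdge-true∷-1 : ∀ {n} b (bs : Vec Bool n) S → isEdge 1 (b ∷ bs) (true ∷ S) ≡ (card S ≡ᵇ 0) ∧ b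
isEdge-true∷-1 b bs S with largest S in eq
... | nothing rewrite largest≡nothing⇒card≡0 S eq = refl
... | just _ with card S | largest≡just⇒card>0 S eq
...   | suc _ | _ = refl

-- An edge of size at least 2 through the first vertex has its largest element in the tail, so the
-- deciding bit lies there.
isEdge-true∷ : ∀ d {n} b (bs : Vec Bool n) S → isEdge (2 + d) (b ∷ bs) (true ∷ S) ≡ isEdge (1 + d) bs S
isEdge-true∷ d b bs S with largest S in eq
... | just _ = refl
... | nothing rewrite largest≡nothing⇒card≡0 S eq = refl

-- The edge size is free because fixing the first vertex in an edge lowers it by one.
containsEdge : ℕ → ∀ {n} → Vec Bool n → VSet n → Bool
containsEdge d {n} bs W = any (λ S → (S ⊆ᵇ W) ∧ isEdge d bs S) (allSubsets n)

containsEdge-false∷ : ∀ d {n} b (bs : Vec Bool n) W →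
  containsEdge d (b ∷ bs) (false ∷ W) ≡ containsEdge d bs W
containsEdge-false∷ d {n} b bs W = begin
  containsEdge d (b ∷ bs) (false ∷ W)
    ≡⟨ any-allSubsets (λ S → (S ⊆ᵇ (false ∷ W)) ∧ isEdge d (b ∷ bs) S) ⟩
  _ ∨ any (λ _ → false) (allSubsets n)
    ≡⟨ cong₂ _∨_ (any-cong (λ S → cong ((S ⊆ᵇ W) ∧_) (isEdge-false∷ d b bs S)) (allSubsets n)) (any-false (allSubsets n)) ⟩
  containsEdge d bs W ∨ false
    ≡⟨ ∨-identityʳ _ ⟩
  containsEdge d bs W ∎
  where open ≡-Reasoning

containsEdge-true∷ : ∀ d {n} b (bs : Vec Bool n) W →
  containsEdge d (b ∷ bs) (true ∷ W) ≡
  containsEdge d bs W ∨ any (λ S → (S ⊆ᵇ W) ∧ isEdge d (b ∷ bs) (true ∷ S)) (allSubsets n)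
containsEdge-true∷ d {n} b bs W = trans
  (any-allSubsets (λ S → (S ⊆ᵇ (true ∷ W)) ∧ isEdge d (b ∷ bs) S))
  (cong (_∨ any (λ S → (S ⊆ᵇ W) ∧ isEdge d (b ∷ bs) (true ∷ S)) (allSubsets n))
    (any-cong (λ S → cong ((S ⊆ᵇ W) ∧_) (isEdge-false∷ d b bs S)) (allSubsets n)))

any-⊆∧card≡0 : ∀ {n} b (W : VSet n) → any (λ S → (S ⊆ᵇ W) ∧ ((card S ≡ᵇ 0) ∧ b)) (allSubsets n) ≡ b
any-⊆∧card≡0 b [] = ∨-identityʳ b
any-⊆∧card≡0 {suc n} b (x ∷ W) = begin
  any (λ S → (S ⊆ᵇ (x ∷ W)) ∧ ((card S ≡ᵇ 0) ∧ b)) (allSubsets (suc n))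
    ≡⟨ any-allSubsets (λ S → (S ⊆ᵇ (x ∷ W)) ∧ ((card S ≡ᵇ 0) ∧ b)) ⟩
  any (λ S → (S ⊆ᵇ W) ∧ ((card S ≡ᵇ 0) ∧ b)) (allSubsets n) ∨ any (λ S → ((x ∧ (S ⊆ᵇ W)) ∧ false)) (allSubsets n)
    ≡⟨ cong₂ _∨_ (any-⊆∧card≡0 b W) (trans (any-cong (λ S → ∧-zeroʳ (x ∧ (S ⊆ᵇ W))) (allSubsets n)) (any-false (allSubsets n))) ⟩
  b ∨ false
    ≡⟨ ∨-identityʳ b ⟩
  b ∎
  where open ≡-Reasoning

-- A greedy scan: an edge inside W exists iff some vertex of W with bit 1 is preceded by at least
-- r = k - 1 vertices of W; the argument r counts down the vertices still to be seen.
reachesEdge : ℕ → ∀ {n} → Vec Bool n → VSet n → Bool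
reachesEdge r       []       []          = false
reachesEdge r       (b ∷ bs) (false ∷ W) = reachesEdge r bs W
reachesEdge zero    (b ∷ bs) (true ∷ W)  = b ∨ reachesEdge zero bs W
reachesEdge (suc r) (b ∷ bs) (true ∷ W)  = reachesEdge r bs W

-- Asking for fewer earlier vertices is weaker, so the first disjunct implies the second.
reachesEdge-absorb : ∀ r {n} (bs : Vec Bool n) W →
  reachesEdge (suc r) bs W ∨ reachesEdge r bs W ≡ reachesEdge r bs W
reachesEdge-absorb r       []           []          = refl
reachesEdge-absorb r       (b ∷ bs)     (false ∷ W) = reachesEdge-absorb r bs W
reachesEdge-absorb zero    (true ∷ bs)  (true ∷ W)  = ∨-zeroʳ _
reachesEdge-absorb zero    (false ∷ bs) (true ∷ W)  = ∨-idem _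
reachesEdge-absorb (suc r) (b ∷ bs)     (true ∷ W)  = reachesEdge-absorb r bs W

-- Edges avoid a chosen first vertex or pass through it and then need one vertex fewer; by
-- `reachesEdge-absorb` the second alternative subsumes the first. At edge size 1 the first vertex
-- alone is an edge when its bit is 1.
containsEdge≡reachesEdge : ∀ r {n} (bs : Vec Bool n) W → containsEdge (suc r) bs W ≡ reachesEdge r bs W
containsEdge≡reachesEdge r [] [] = refl
containsEdge≡reachesEdge r (b ∷ bs) (false ∷ W) =
  trans (containsEdge-false∷ (suc r) b bs W) (containsEdge≡reachesEdge r bs W)
containsEdge≡reachesEdge zero {suc n} (b ∷ bs) (true ∷ W) = begin
  containsEdge 1 (b ∷ bs) (true ∷ W)
    ≡⟨ containsEdge-true∷ 1 b bs W ⟩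
  containsEdge 1 bs W ∨ any (λ S → (S ⊆ᵇ W) ∧ isEdge 1 (b ∷ bs) (true ∷ S)) (allSubsets n)
    ≡⟨ cong₂ _∨_ (containsEdge≡reachesEdge 0 bs W)
         (trans (any-cong (λ S → cong ((S ⊆ᵇ W) ∧_) (isEdge-true∷-1 b bs S)) (allSubsets n)) (any-⊆∧card≡0 b W)) ⟩
  reachesEdge 0 bs W ∨ b
    ≡⟨ ∨-comm _ b ⟩
  b ∨ reachesEdge 0 bs W ∎
  where open ≡-Reasoning
containsEdge≡reachesEdge (suc r) {suc n} (b ∷ bs) (true ∷ W) = begin
  containsEdge (2 + r) (b ∷ bs) (true ∷ W)
    ≡⟨ containsEdge-true∷ (2 + r) b bs W ⟩
  containsEdge (2 + r) bs W ∨ any (λ S → (S ⊆ᵇ W) ∧ isEdge (2 + r) (b ∷ bs) (true ∷ S)) (allSubsets n)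
    ≡⟨ cong₂ _∨_ (containsEdge≡reachesEdge (suc r) bs W)
         (trans (any-cong (λ S → cong ((S ⊆ᵇ W) ∧_) (isEdge-true∷ r b bs S)) (allSubsets n)) (containsEdge≡reachesEdge r bs W)) ⟩
  reachesEdge (suc r) bs W ∨ reachesEdge r bs W
    ≡⟨ reachesEdge-absorb r bs W ⟩
  reachesEdge r bs W ∎
  where open ≡-Reasoning

-- Counting independent sets

countSat : ∀ {n} → (VSet n → Bool) → ℕ → List (VSet n) → ℕ
countSat p i Ws = length (filter (λ W → card W ℕ.≟ i) (filter (λ W → p W Bool.≟ true) Ws))

countSat-++ : ∀ {n} (p : VSet n → Bool) i Ws Ws′ → countSat p i (Ws ++ Ws′) ≡ countSat p i Ws + countSat p i Ws′
countSat-++ p i Ws Ws′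
  rewrite filter-++ (λ W → p W Bool.≟ true) Ws Ws′
        | filter-++ (λ W → card W ℕ.≟ i) (filter (λ W → p W Bool.≟ true) Ws) (filter (λ W → p W Bool.≟ true) Ws′)
  = length-++ (filter (λ W → card W ℕ.≟ i) (filter (λ W → p W Bool.≟ true) Ws))

countSat-false∷ : ∀ {n} (p : VSet (suc n) → Bool) i Ws →
  countSat p i (map (false ∷_) Ws) ≡ countSat (p ∘ (false ∷_)) i Ws
countSat-false∷ p i [] = refl
countSat-false∷ p i (W ∷ Ws) with p (false ∷ W)
... | false = countSat-false∷ p i Ws
... | true with card W ≡ᵇ i
...   | false = countSat-false∷ p i Ws
...   | true  = cong suc (countSat-false∷ p i Ws)

countSat-true∷ : ∀ {n} (p : VSet (suc n) → Bool) i Ws →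
  countSat p (suc i) (map (true ∷_) Ws) ≡ countSat (p ∘ (true ∷_)) i Ws
countSat-true∷ p i [] = refl
countSat-true∷ p i (W ∷ Ws) with p (true ∷ W)
... | false = countSat-true∷ p i Ws
... | true with card W ≡ᵇ i
...   | false = countSat-true∷ p i Ws
...   | true  = cong suc (countSat-true∷ p i Ws)

countSat-true∷-0 : ∀ {n} (p : VSet (suc n) → Bool) Ws → countSat p 0 (map (true ∷_) Ws) ≡ 0
countSat-true∷-0 p [] = refl
countSat-true∷-0 p (W ∷ Ws) with p (true ∷ W)
... | false = countSat-true∷-0 p Ws
... | true  = countSat-true∷-0 p Ws

countSat-cong : ∀ {n} {p q : VSet n → Bool} → p ≗ q → ∀ i Ws → countSat p i Ws ≡ countSat q i Ws
countSat-cong p≗q i [] = refl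
countSat-cong {p = p} {q} p≗q i (W ∷ Ws) with p W | q W | p≗q W
... | false | .false | refl = countSat-cong p≗q i Ws
... | true  | .true  | refl with card W ≡ᵇ i
...   | false = countSat-cong p≗q i Ws
...   | true  = cong suc (countSat-cong p≗q i Ws)

countSat-none : ∀ {n} i (Ws : List (VSet n)) → countSat (λ _ → false) i Ws ≡ 0
countSat-none i []       = refl
countSat-none i (W ∷ Ws) = countSat-none i Ws

-- Follows the scan `reachesEdge`: `r` drops with each chosen vertex, and a bit forbids sets only
-- once `r` is zero.
countIndep : ℕ → ∀ {n} → Vec Bool n → ℕ → ℕ
countIndep r       []       zero    = 1
countIndep r       []       (suc i) = 0
countIndep r       (b ∷ bs) zero    = countIndep r bs zero
countIndep zero    (b ∷ bs) (suc i) = countIndep zero bs (suc i) + (if b then 0 else countIndep zero bs i)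
countIndep (suc r) (b ∷ bs) (suc i) = countIndep (suc r) bs (suc i) + countIndep r bs i

countSat≡countIndep : ∀ r {n} (bs : Vec Bool n) i →
  countSat (not ∘ reachesEdge r bs) i (allSubsets n) ≡ countIndep r bs i
countSat≡countIndep r [] zero    = refl
countSat≡countIndep r [] (suc i) = refl
countSat≡countIndep r {suc n} (b ∷ bs) zero = begin
  countSat p 0 (allSubsets (suc n))
    ≡⟨ countSat-++ p 0 (map (false ∷_) (allSubsets n)) _ ⟩
  countSat p 0 (map (false ∷_) (allSubsets n)) + countSat p 0 (map (true ∷_) (allSubsets n))
    ≡⟨ cong₂ _+_ (trans (countSat-false∷ p 0 (allSubsets n)) (countSat≡countIndep r bs 0))
                 (countSat-true∷-0 p (allSubsets n)) ⟩
  countIndep r bs 0 + 0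
    ≡⟨ +-identityʳ _ ⟩
  countIndep r bs 0 ∎
  where
  open ≡-Reasoning
  p = not ∘ reachesEdge r (b ∷ bs)
countSat≡countIndep r {suc n} (b ∷ bs) (suc i) = begin
  countSat p (suc i) (allSubsets (suc n))
    ≡⟨ countSat-++ p (suc i) (map (false ∷_) (allSubsets n)) _ ⟩
  countSat p (suc i) (map (false ∷_) (allSubsets n)) + countSat p (suc i) (map (true ∷_) (allSubsets n))
    ≡⟨ cong₂ _+_ (trans (countSat-false∷ p (suc i) (allSubsets n)) (countSat≡countIndep r bs (suc i)))
                 (countSat-true∷ p i (allSubsets n)) ⟩
  countIndep r bs (suc i) + countSat (p ∘ (true ∷_)) i (allSubsets n)
    ≡⟨ first-chosen r b ⟩
  countIndep r (b ∷ bs) (suc i) ∎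
  where
  open ≡-Reasoning
  p = not ∘ reachesEdge r (b ∷ bs)
  first-chosen : ∀ r b →
    countIndep r bs (suc i) + countSat (not ∘ reachesEdge r (b ∷ bs) ∘ (true ∷_)) i (allSubsets n)
      ≡ countIndep r (b ∷ bs) (suc i)
  first-chosen zero    true  = cong (countIndep 0 bs (suc i) +_) (countSat-none i (allSubsets n))
  first-chosen zero    false = cong (countIndep 0 bs (suc i) +_) (countSat≡countIndep 0 bs i)
  first-chosen (suc r) b     = cong (countIndep (suc r) bs (suc i) +_) (countSat≡countIndep r bs i)

indepCoeff≡countIndep : ∀ r {n} (bs : Vec Bool n) i → indepCoeff (suc r) bs i ≡ countIndep r bs i
indepCoeff≡countIndep r {n} bs i = trans
  (countSat-cong (λ W → cong not (containsEdge≡reachesEdge r bs W)) i (allSubsets n))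
  (countSat≡countIndep r bs i)

countIndep-0 : ∀ r {n} (bs : Vec Bool n) → countIndep r bs 0 ≡ 1
countIndep-0 r []       = refl
countIndep-0 r (b ∷ bs) = countIndep-0 r bs

<ᵇsuc≡≤ᵇ : ∀ m n → (m ℕ.<ᵇ suc n) ≡ (m ≤ᵇ n)
<ᵇsuc≡≤ᵇ zero    n = refl
<ᵇsuc≡≤ᵇ (suc m) n = refl

-- Interchanges expansion at the first vertex (guard `c`) and at the last (guard `b`): `w`, `x`,
-- `y`, `z` count the sets with neither, only the last, only the first, and both chosen.
if-exchange : ∀ b c w x y z →
  (w + (if b then 0 else x)) + (if c then 0 else (y + (if b then 0 else z))) ≡
  (w + (if c then 0 else y)) + (if b then 0 else (x + (if c then 0 else z)))
if-exchange true  true  w x y z = refl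
if-exchange true  false w x y z = lemma w y
  where
  lemma : ∀ w y → w + 0 + (y + 0) ≡ w + y + 0
  lemma = solve-∀
if-exchange false true  w x y z = lemma w x
  where
  lemma : ∀ w x → w + x + 0 ≡ w + 0 + (x + 0)
  lemma = solve-∀
if-exchange false false w x y z = lemma w x y z
  where
  lemma : ∀ w x y z → w + x + (y + z) ≡ w + y + (x + z)
  lemma = solve-∀

-- `countIndep` recurses from the front, while antiregular strings grow at the back. A chosen last
-- vertex with bit 1 completes an edge exactly when the `i` other chosen vertices number at least
-- `r`.
countIndep-∷ʳ : ∀ r {n} (bs : Vec Bool n) b i →
  countIndep r (bs ∷ʳ b) (suc i) ≡ countIndep r bs (suc i) + (if b ∧ (r ≤ᵇ i) then 0 else countIndep r bs i)
countIndep-∷ʳ zero [] b i rewrite ∧-identityʳ b = refl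
countIndep-∷ʳ (suc r) [] b zero rewrite ∧-zeroʳ b = refl
countIndep-∷ʳ (suc r) [] b (suc i) with b ∧ (r ℕ.<ᵇ suc i)
... | true  = refl
... | false = refl
countIndep-∷ʳ zero (c ∷ bs) b zero
  rewrite countIndep-∷ʳ 0 bs b 0 | ∧-identityʳ b | countIndep-0 0 (bs ∷ʳ b) | countIndep-0 0 bs
  = xy∙z (countIndep 0 bs 1) _ _
  where
  xy∙z : ∀ x y z → x + y + z ≡ x + z + y
  xy∙z = solve-∀
countIndep-∷ʳ zero (c ∷ bs) b (suc i)
  rewrite countIndep-∷ʳ 0 bs b (suc i) | countIndep-∷ʳ 0 bs b i | ∧-identityʳ b
  = if-exchange b c (countIndep 0 bs (2 + i)) (countIndep 0 bs (1 + i)) (countIndep 0 bs (1 + i)) (countIndep 0 bs i)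
countIndep-∷ʳ (suc r) (c ∷ bs) b zero
  rewrite countIndep-∷ʳ (suc r) bs b 0 | ∧-zeroʳ b | countIndep-0 r (bs ∷ʳ b) | countIndep-0 r bs | countIndep-0 (suc r) bs = refl
-- While `suc r` earlier vertices are required, the first vertex cannot complete an edge; hence its
-- guard is `false`.
countIndep-∷ʳ (suc r) (c ∷ bs) b (suc i)
  rewrite countIndep-∷ʳ (suc r) bs b (suc i) | countIndep-∷ʳ r bs b i | <ᵇsuc≡≤ᵇ r i
  = if-exchange (b ∧ (r ≤ᵇ i)) false
      (countIndep (suc r) bs (2 + i)) (countIndep (suc r) bs (1 + i)) (countIndep r bs (1 + i)) (countIndep r bs i)

countIndep->n : ∀ r {n} (bs : Vec Bool n) i → n < i → countIndep r bs i ≡ 0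
countIndep->n r       []           (suc i) _         = refl
countIndep->n zero    (true ∷ bs)  (suc i) (s≤s n<i) = cong (_+ 0) (countIndep->n 0 bs (suc i) (m≤n⇒m≤1+n n<i))
countIndep->n zero    (false ∷ bs) (suc i) (s≤s n<i) =
  cong₂ _+_ (countIndep->n 0 bs (suc i) (m≤n⇒m≤1+n n<i)) (countIndep->n 0 bs i n<i)
countIndep->n (suc r) (b ∷ bs)     (suc i) (s≤s n<i) =
  cong₂ _+_ (countIndep->n (suc r) bs (suc i) (m≤n⇒m≤1+n n<i)) (countIndep->n r bs i n<i)

-- Antiregular strings

tabulate-∷ʳ : ∀ {A : Set} (h : ℕ → A) n →
  tabulate {n = suc n} (h ∘ toℕ) ≡ tabulate {n = n} (h ∘ toℕ) ∷ʳ h n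
tabulate-∷ʳ h zero    = refl
tabulate-∷ʳ h (suc n) = cong (h 0 ∷_) (tabulate-∷ʳ (h ∘ suc) n)

if-not : ∀ b c → (if not b then c else not c) ≡ (if b then not c else not (not c))
if-not true  c = refl
if-not false c = sym (not-involutive c)

-- Bits are fixed by the parity of the distance to the end, so dropping the last one flips the
-- prescribed final bit. The appended bit is 0 when its position `n + 1` is below `k = r + 1`.
antiregularString-∷ʳ : ∀ r n l →
  antiregularString (suc r) (suc n) l ≡
  antiregularString (suc r) n (not l) ∷ʳ (if r ≤ᵇ n then l else false)
antiregularString-∷ʳ r n l = begin
  antiregularString (suc r) (suc n) l          ≡⟨ tabulate-∷ʳ bit n ⟩
  tabulate (bit ∘ toℕ) ∷ʳ bit n                ≡⟨ cong₂ _∷ʳ_ (tabulate-cong earlier) last ⟩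
  antiregularString (suc r) n (not l) ∷ʳ (if r ≤ᵇ n then l else false) ∎
  where
  open ≡-Reasoning
  bit : ℕ → Bool
  bit i = if r ℕ.<ᵇ suc i then (if even (suc n ∸ suc i) then l else not l) else false
  last : bit n ≡ (if r ≤ᵇ n then l else false)
  last rewrite n∸n≡0 n | <ᵇsuc≡≤ᵇ r n = refl
  earlier : ∀ (i : Fin n) → bit (toℕ i) ≡
    (if r ℕ.<ᵇ suc (toℕ i) then (if even (n ∸ suc (toℕ i)) then not l else not (not l)) else false)
  earlier i = cong (if r ℕ.<ᵇ suc (toℕ i) then_else false) (trans
    (cong (if_then l else not l) (cong even (+-∸-assoc 1 (toℕ<n i))))
    (if-not (even (n ∸ suc (toℕ i))) l))

countIndep≡coeff : ∀ r l n i → countIndep r (antiregularString (suc r) n l) i ≡ coeff r l n i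
countIndep≡coeff r l zero zero    = refl
countIndep≡coeff r l zero (suc i) = refl
countIndep≡coeff r l (suc n) zero = countIndep-0 r (antiregularString (suc r) (suc n) l)
countIndep≡coeff r l (suc n) (suc i) = begin
  countIndep r (antiregularString (suc r) (suc n) l) (suc i)
    ≡⟨ cong (λ bs → countIndep r bs (suc i)) (antiregularString-∷ʳ r n l) ⟩
  countIndep r (string ∷ʳ last) (suc i)
    ≡⟨ countIndep-∷ʳ r string last i ⟩
  countIndep r string (suc i) + (if last ∧ (r ≤ᵇ i) then 0 else countIndep r string i)
    ≡⟨ cong (countIndep r string (suc i) +_) drop-guard ⟩
  countIndep r string (suc i) + (if l ∧ (r ≤ᵇ i) then 0 else countIndep r string i)
    ≡⟨ cong₂ (λ x y → x + (if l ∧ (r ≤ᵇ i) then 0 else y))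
         (countIndep≡coeff r (not l) n (suc i)) (countIndep≡coeff r (not l) n i) ⟩
  coeff r l (suc n) (suc i) ∎
  where
  open ≡-Reasoning
  string = antiregularString (suc r) n (not l)
  last = if r ≤ᵇ n then l else false
  drop-guard : (if last ∧ (r ≤ᵇ i) then 0 else countIndep r string i) ≡
               (if l ∧ (r ≤ᵇ i) then 0 else countIndep r string i)
  -- For `n < r` the appended bit is 0 while `coeff` still tests `l`. The guards can differ only for
  -- `r ≤ i`, and then `n < i`, so the count is zero either way.
  drop-guard with r ≤? n
  ... | yes r≤n rewrite ≤⇒≤ᵇ≡true r≤n = refl
  ... | no  r≰n rewrite <⇒≤ᵇ≡false (≰⇒> r≰n) with r ≤? i
  ...   | no  r≰i rewrite <⇒≤ᵇ≡false (≰⇒> r≰i) | ∧-zeroʳ l = refl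
  ...   | yes r≤i rewrite countIndep->n r string i (≤-trans (≰⇒> r≰n) r≤i) = sym (if-same (l ∧ (r ≤ᵇ i)))
    where
    if-same : ∀ b → (if b then 0 else 0) ≡ 0
    if-same true  = refl
    if-same false = refl

-- Transfer to the independence polynomials

indepCoeff≡coeff : ∀ r l n i → indepCoeff (suc r) (antiregularString (suc r) n l) i ≡ coeff r l n i
indepCoeff≡coeff r l n i =
  trans (indepCoeff≡countIndep r (antiregularString (suc r) n l) i) (countIndep≡coeff r l n i)

-- `coeff-logConcave` holds at every index, in particular below the degree; `k ≥ 2` makes
-- `r = k - 1` the successor that it asks for.
antiregular-logConcave : ∀ k → 2 ≤ k → ∀ n l → IndepPolyLogConcave k (antiregularString k n l)
antiregular-logConcave (suc (suc r-1)) (s≤s (s≤s _)) n l (suc i) _ _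
  rewrite +-comm i 1
        | indepCoeff≡coeff (suc r-1) l n i
        | indepCoeff≡coeff (suc r-1) l n (1 + i)
        | indepCoeff≡coeff (suc r-1) l n (2 + i)
  = coeff-logConcave r-1 l n .logConcave i

theorem3p4 : (k : ℕ) → 3 ≤ k → (n : ℕ) → 1 ≤ n →
    IndepPolyLogConcave k (A k n) × IndepPolyLogConcave k (Abar k n)
theorem3p4 k 3≤k n _ = antiregular-logConcave k 2≤k n true , antiregular-logConcave k 2≤k n false
  where
  2≤k : 2 ≤ k
  2≤k = <⇒≤ 3≤k
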